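{- $\mathcal I\subsetneq\mathcal U$, where $\mathcal I$ is the set of processes $P$ such that $\Gamma;\Delta\vdash_{\mathcal I}P::x:A$ is derivable in $\pi\mathsf{ILL}$ for some $\Gamma,\Delta,x,A$, and $\mathcal U$ is the set of processes $P$ such that $\Gamma;\Delta\vdash P::\Lambda$ is derivable in $\pi\mathsf{ULL}$ for some $\Gamma,\Delta,\Lambda$. (For instance, $x(y).x(\,).y[\,].\mathbf 0\in\mathcal U\setminus\mathcal I$.)
   Context: **Types.** $A,B::=\mathbf 1\mid\bot\mid A\otimes B\mid A\multimap B\mid \oplus\{i:A_i\}_{i\in I}\mid \&\{i:A_i\}_{i\in I}\mid {!}A\mid {?}A$. **Duality**: $\mathbf 1^\perp=\bot$, $\bot^\perp=\mathbf 1$, $(A\otimes B)^\perp=A\multimap B^\perp$, $(A\multimap B)^\perp=A\otimes B^\perp$, $(\oplus\{i:A_i\})^\perp=\&\{i:A_i^\perp\}$, $(\&\{i:A_i\})^\perp=\oplus\{i:A_i^\perp\}$, $({!}A)^\perp={?}A^\perp$, $({?}A)^\perp={!}A^\perp$; $A⅋B:=A^\perp\multimap B$. **Processes.** $P,Q::=\mathbf 0\mid \nu x\,P\mid P|Q\mid x[y].P\mid x(y).P\mid x\triangleleft \ell.P\mid x\triangleright\{i:P_i\}_{i\in I}\mid {!}x(y).P\mid [x\leftrightarrow y]\mid x[\,].P\mid x(\,).P$ (send, receive, select, branch, replicated receive, forwarder, empty send, empty receive). $y$ is bound in $\nu y\,P$, $x(y).P$, ${!}x(y).P$; processes up to $\alpha$-renaming;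 $P\{y/x\}$ capture-avoiding substitution. **Type system $\pi\mathsf{ULL}$.** Judgments $\Gamma;\Delta\vdash P::\Lambda$ ($\Gamma$ unrestricted, $\Delta,\Lambda$ linear; finite sets of $x:A$ with distinct names; comma = disjoint union). Rules ($\Gamma$ shared): (idR) $\Gamma;x:A\vdash[x\leftrightarrow y]::y:A$. (idL) $\Gamma;x:A,y:A^\perp\vdash[x\leftrightarrow y]::\emptyset$. (1R) $\Gamma;\emptyset\vdash x[\,].\mathbf 0::x:\mathbf 1$. (1L) $\Gamma;\Delta\vdash P::\Lambda\Rightarrow\Gamma;\Delta,x:\mathbf 1\vdash x(\,).P::\Lambda$. (⊥R) $\Gamma;\Delta\vdash P::\Lambda\Rightarrow\Gamma;\Delta\vdash x(\,).P::\Lambda,x:\bot$. (⊥L) $\Gamma;x:\bot\vdash x[\,].\mathbf 0::\emptyset$. (⊗R) $\Gamma;\Delta\vdash P::\Lambda,y:A$, $\Gamma;\Delta'\vdash Q::\Lambda',x:B\Rightarrow\Gamma;\Delta,\Delta'\vdash\nu y\,x[y].(P|Q)::\Lambda,\Lambda',x:A\otimes B$. (⊗L) $\Gamma;\Delta,y:A,x:B\vdash P::\Lambda\Rightarrow\Gamma;\Delta,x:A\otimes B\vdash x(y).P::\Lambda$. (⅋R) $\Gamma;\Delta\vdash P::\Lambda,y:A,x:B\Rightarrow\Gamma;\Delta\vdash x(y).P::\Lambda,x:A⅋B$. (⅋L) $\Gamma;\Delta,y:A\vdash P::\Lambda$, $\Gamma;\Delta',x:B\vdash Q::\Lambda'\Rightarrow\Gamma;\Delta,\Delta',x:A⅋B\vdash\nu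 y\,x[y].(P|Q)::\Lambda,\Lambda'$. (⊸R) $\Gamma;\Delta,y:A\vdash P::\Lambda,x:B\Rightarrow\Gamma;\Delta\vdash x(y).P::\Lambda,x:A\multimap B$. (⊸L) $\Gamma;\Delta\vdash P::\Lambda,y:A$, $\Gamma;\Delta',x:B\vdash Q::\Lambda'\Rightarrow\Gamma;\Delta,\Delta',x:A\multimap B\vdash\nu y\,x[y].(P|Q)::\Lambda,\Lambda'$. (⊕R) $\Gamma;\Delta\vdash P::\Lambda,x:A_j$, $j\in I\Rightarrow\Gamma;\Delta\vdash x\triangleleft j.P::\Lambda,x:\oplus\{i:A_i\}_{i\in I}$. (⊕L) $\forall i\in I.\ \Gamma;\Delta,x:A_i\vdash P_i::\Lambda\Rightarrow\Gamma;\Delta,x:\oplus\{i:A_i\}_{i\in I}\vdash x\triangleright\{i:P_i\}_{i\in I}::\Lambda$. (&R) $\forall i\in I.\ \Gamma;\Delta\vdash P_i::\Lambda,x:A_i\Rightarrow\Gamma;\Delta\vdash x\triangleright\{i:P_i\}_{i\in I}::\Lambda,x:\&\{i:A_i\}_{i\in I}$. (&L) $\Gamma;\Delta,x:A_j\vdash P::\Lambda$, $j\in I\Rightarrow\Gamma;\Delta,x:\&\{i:A_i\}_{i\in I}\vdash x\triangleleft j.P::\Lambda$. (copyR) $\Gamma,u:A;\Delta\vdash P::\Lambda,x:A^\perp\Rightarrow\Gamma,u:A;\Delta\vdash\nu x\,u[x].P::\Lambda$. (copyL) $\Gamma,u:A;\Delta,x:A\vdash P::\Lambda\Rightarrow\Gamma,u:A;\Delta\vdash\nu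 x\,u[x].P::\Lambda$. (!R) $\Gamma;\emptyset\vdash P::y:A\Rightarrow\Gamma;\emptyset\vdash{!}x(y).P::x:{!}A$. (!L) $\Gamma,u:A;\Delta\vdash P::\Lambda\Rightarrow\Gamma;\Delta,x:{!}A\vdash P\{x/u\}::\Lambda$. (?R) $\Gamma,u:A;\Delta\vdash P::\Lambda\Rightarrow\Gamma;\Delta\vdash P\{x/u\}::\Lambda,x:{?}A^\perp$. (?L) $\Gamma;y:A\vdash P::\emptyset\Rightarrow\Gamma;x:{?}A\vdash{!}x(y).P::\emptyset$. (cutRL) $\Gamma;\Delta\vdash P::\Lambda,x:A$, $\Gamma;\Delta',x:A\vdash Q::\Lambda'\Rightarrow\Gamma;\Delta,\Delta'\vdash\nu x(P|Q)::\Lambda,\Lambda'$; (cutLR) premises $\Gamma;\Delta,x:A\vdash P::\Lambda$, $\Gamma;\Delta'\vdash Q::\Lambda',x:A$; (cutRR) premises $\Gamma;\Delta\vdash P::\Lambda,x:A$, $\Gamma;\Delta'\vdash Q::\Lambda',x:A^\perp$; (cutLL) premises $\Gamma;\Delta,x:A\vdash P::\Lambda$, $\Gamma;\Delta',x:A^\perp\vdash Q::\Lambda'$ (same conclusion). (cut!R) $\Gamma,u:A;\Delta\vdash P::\Lambda$, $\Gamma;\emptyset\vdash Q::x:A\Rightarrow\Gamma;\Delta\vdash\nu u(P|{!}u(x).Q)::\Lambda$. (cut!L) $\Gamma;\emptyset\vdash P::x:A$, $\Gamma,u:A;\Delta\vdash Q::\Lambda\Rightarrow\Gamma;\Delta\vdash\nu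 u({!}u(x).P|Q)::\Lambda$. (cut?R) $\Gamma,u:A;\Delta\vdash P::\Lambda$, $\Gamma;x:A^\perp\vdash Q::\emptyset\Rightarrow\Gamma;\Delta\vdash\nu u(P|{!}u(x).Q)::\Lambda$. (cut?L) $\Gamma;x:A^\perp\vdash P::\emptyset$, $\Gamma,u:A;\Delta\vdash Q::\Lambda\Rightarrow\Gamma;\Delta\vdash\nu u({!}u(x).P|Q)::\Lambda$. **$\pi\mathsf{ILL}$**: types $A,B::=\mathbf 1\mid A\otimes B\mid A\multimap B\mid\oplus\{i:A_i\}_{i\in I}\mid\&\{i:A_i\}_{i\in I}\mid{!}A$ (no $\bot$, no ${?}$); judgments $\Gamma;\Delta\vdash_{\mathcal I}P::z:C$ (exactly one assignment on the right). Rules: (id) $\Gamma;x:A\vdash_{\mathcal I}[x\leftrightarrow y]::y:A$. (1R) $\Gamma;\emptyset\vdash_{\mathcal I}x[\,].\mathbf 0::x:\mathbf 1$. (1L) $\Gamma;\Delta\vdash_{\mathcal I}P::z:C\Rightarrow\Gamma;\Delta,x:\mathbf 1\vdash_{\mathcal I}x(\,).P::z:C$. (⊗R) $\Gamma;\Delta\vdash_{\mathcal I}P::y:A$, $\Gamma;\Delta'\vdash_{\mathcal I}Q::x:B\Rightarrow\Gamma;\Delta,\Delta'\vdash_{\mathcal I}\nu y\,x[y].(P|Q)::x:A\otimes B$. (⊗L) $\Gamma;\Delta,y:A,x:B\vdash_{\mathcal I}P::z:C\Rightarrow\Gamma;\Delta,x:A\otimes B\vdash_{\mathcal I}x(y).P::z:C$.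 (⊸R) $\Gamma;\Delta,y:A\vdash_{\mathcal I}P::x:B\Rightarrow\Gamma;\Delta\vdash_{\mathcal I}x(y).P::x:A\multimap B$. (⊸L) $\Gamma;\Delta\vdash_{\mathcal I}P::y:A$, $\Gamma;\Delta',x:B\vdash_{\mathcal I}Q::z:C\Rightarrow\Gamma;\Delta,\Delta',x:A\multimap B\vdash_{\mathcal I}\nu y\,x[y].(P|Q)::z:C$. (⊕R) $\Gamma;\Delta\vdash_{\mathcal I}P::x:A_j$, $j\in I\Rightarrow\Gamma;\Delta\vdash_{\mathcal I}x\triangleleft j.P::x:\oplus\{i:A_i\}_{i\in I}$. (⊕L) $\forall i.\ \Gamma;\Delta,x:A_i\vdash_{\mathcal I}P_i::z:C\Rightarrow\Gamma;\Delta,x:\oplus\{i:A_i\}_{i\in I}\vdash_{\mathcal I}x\triangleright\{i:P_i\}_{i\in I}::z:C$. (&R) $\forall i.\ \Gamma;\Delta\vdash_{\mathcal I}P_i::x:A_i\Rightarrow\Gamma;\Delta\vdash_{\mathcal I}x\triangleright\{i:P_i\}_{i\in I}::x:\&\{i:A_i\}_{i\in I}$. (&L) $\Gamma;\Delta,x:A_j\vdash_{\mathcal I}P::z:C$, $j\in I\Rightarrow\Gamma;\Delta,x:\&\{i:A_i\}_{i\in I}\vdash_{\mathcal I}x\triangleleft j.P::z:C$. (copy) $\Gamma,u:A;\Delta,x:A\vdash_{\mathcal I}P::z:C\Rightarrow\Gamma,u:A;\Delta\vdash_{\mathcal I}\nu x\,u[x].P::z:C$. (!R) $\Gamma;\emptyset\vdash_{\mathcal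 I}P::y:A\Rightarrow\Gamma;\emptyset\vdash_{\mathcal I}{!}x(y).P::x:{!}A$. (!L) $\Gamma,u:A;\Delta\vdash_{\mathcal I}P::z:C\Rightarrow\Gamma;\Delta,x:{!}A\vdash_{\mathcal I}P\{x/u\}::z:C$. (cutRL) $\Gamma;\Delta\vdash_{\mathcal I}P::x:A$, $\Gamma;\Delta',x:A\vdash_{\mathcal I}Q::z:C\Rightarrow\Gamma;\Delta,\Delta'\vdash_{\mathcal I}\nu x(P|Q)::z:C$. (cutLR) $\Gamma;\Delta,x:A\vdash_{\mathcal I}P::z:C$, $\Gamma;\Delta'\vdash_{\mathcal I}Q::x:A\Rightarrow\Gamma;\Delta,\Delta'\vdash_{\mathcal I}\nu x(P|Q)::z:C$. (cut!R) $\Gamma,u:A;\Delta\vdash_{\mathcal I}P::z:C$, $\Gamma;\emptyset\vdash_{\mathcal I}Q::x:A\Rightarrow\Gamma;\Delta\vdash_{\mathcal I}\nu u(P|{!}u(x).Q)::z:C$. (cut!L) $\Gamma;\emptyset\vdash_{\mathcal I}P::x:A$, $\Gamma,u:A;\Delta\vdash_{\mathcal I}Q::z:C\Rightarrow\Gamma;\Delta\vdash_{\mathcal I}\nu u({!}u(x).P|Q)::z:C$. -}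

module Defs where

open import Data.Fin using (Fin; zero; _↑ʳ_; _↑ˡ_)
open import Data.List using (List; []; _∷_; _++_; length; map; lookup)
open import Data.List.Membership.Propositional using (_∉_)
open import Data.List.Relation.Binary.Permutation.Propositional using (_↭_)
open import Data.List.Relation.Unary.Linked using (Linked)
open import Data.List.Relation.Unary.Unique.Propositional using (Unique)
open import Data.Nat using (ℕ; zero; suc; _+_; _<_; _≟_)
open import Data.Product using (_×_; _,_; proj₁; ∃-syntax)
open import Data.Vec as Vec using (Vec; []; _∷_)
open import Level using (0ℓ)
open import Relation.Nullary using (yes; no)
open import Relation.Unary using (Pred)

Name : Set
Name = ℕ

Label : Set
Label = ℕ

-- A finite set I of labels, listed in increasing order; a family {i : Aᵢ}_{i∈I}
-- is a vector of length ∣ I ∣.  The ordering (with an irrelevant proof) makes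
-- propositional equality of label sets and of families extensional.
record Labels : Set where
  constructor mkLabels
  field
    labels  : List Label
    .sorted : Linked _<_ labels

open Labels public

∣_∣ : Labels → ℕ
∣ I ∣ = length (labels I)

label : (I : Labels) → Fin ∣ I ∣ → Label
label I = lookup (labels I)

infixr 30 _⊗_ _⊸_ _⅋_
infix  35 !_ ⁇_

-- ⁇ is the exponential ?, which is reserved by Agda.
data Type : Set where
  𝟏 ⊥     : Type
  _⊗_ _⊸_ : Type → Type → Type
  ⊕ &     : (I : Labels) → Vec Type ∣ I ∣ → Type
  !_ ⁇_   : Type → Type

data Typeᴵ : Set where
  𝟏       : Typeᴵ
  _⊗_ _⊸_ : Typeᴵ → Typeᴵ → Typeᴵ
  ⊕ &     : (I : Labels) → Vec Typeᴵ ∣ I ∣ → Typeᴵ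
  !_      : Typeᴵ → Typeᴵ

mutual
  dual : Type → Type
  dual 𝟏        = ⊥
  dual ⊥        = 𝟏
  dual (A ⊗ B)  = A ⊸ dual B
  dual (A ⊸ B)  = A ⊗ dual B
  dual (⊕ I As) = & I (duals As)
  dual (& I As) = ⊕ I (duals As)
  dual (! A)    = ⁇ (dual A)
  dual (⁇ A)    = ! (dual A)

  duals : {n : ℕ} → Vec Type n → Vec Type n
  duals []       = []
  duals (A ∷ As) = dual A ∷ duals As

_⅋_ : Type → Type → Type
A ⅋ B = dual A ⊸ B

-- Processes up to α-renaming are represented in locally nameless style: free
-- names are atoms, bound names are de Bruijn indices, so α-equivalence is
-- propositional equality.  Proc n has n dangling indices.
data Chan (n : ℕ) : Set where
  free  : Name → Chan n
  bound : Fin n → Chan n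

data Proc (n : ℕ) : Set where
  nil     : Proc n
  new     : Proc (suc n) → Proc n
  par     : Proc n → Proc n → Proc n
  send    : Chan n → Chan n → Proc n → Proc n
  receive : Chan n → Proc (suc n) → Proc n
  select  : Chan n → Label → Proc n → Proc n
  branch  : Chan n → (I : Labels) → Vec (Proc n) ∣ I ∣ → Proc n
  serve   : Chan n → Proc (suc n) → Proc n
  forward : Chan n → Chan n → Proc n
  close   : Chan n → Proc n → Proc n
  wait    : Chan n → Proc n → Proc n

Process : Set
Process = Proc 0

-- Simultaneous substitution for the free names, under n binders.  The d new
-- indices refer to binders outside those n, hence the shift by n.
module _ {d : ℕ} (σ : Name → Chan d) where

  substChan : {n : ℕ} → Chan n → Chan (n + d)
  substChan {n} (bound i) = bound (i ↑ˡ d)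
  substChan {n} (free x) with σ x
  ... | free y  = free y
  ... | bound j = bound (n ↑ʳ j)

  mutual
    subst : {n : ℕ} → Proc n → Proc (n + d)
    subst nil             = nil
    subst (new P)         = new (subst P)
    subst (par P Q)       = par (subst P) (subst Q)
    subst (send a b P)    = send (substChan a) (substChan b) (subst P)
    subst (receive a P)   = receive (substChan a) (subst P)
    subst (select a ℓ P)  = select (substChan a) ℓ (subst P)
    subst (branch a I Ps) = branch (substChan a) I (substs Ps)
    subst (serve a P)     = serve (substChan a) (subst P)
    subst (forward a b)   = forward (substChan a) (substChan b)
    subst (close a P)     = close (substChan a) (subst P)
    subst (wait a P)      = wait (substChan a) (subst P)

    substs : {n k : ℕ} → Vec (Proc n) k → Vec (Proc (n + d)) k
    substs []       = []
    substs (P ∷ Ps) = subst P ∷ substs Ps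

_↦_ : {d : ℕ} → Name → Chan d → Name → Chan d
(x ↦ a) z with z ≟ x
... | yes _ = a
... | no  _ = free z

-- P ⟨ y / x ⟩ replaces the free name x by y.
_⟨_/_⟩ : Process → Name → Name → Process
P ⟨ y / x ⟩ = subst {0} (x ↦ free y) P

bind : Name → Process → Proc 1
bind x = subst {1} (x ↦ bound zero)

-- ‼ x ⦅ y ⦆· P is the replicated receive !x(y).P (the token ! is the exponential).
infixr 20 _[_]·_ _⦅_⦆·_ _◁_·_ ‼_⦅_⦆·_ _[]·_ _⦅⦆·_
infix  20 _▷_·_
infix  40 _⟨_/_⟩
infixr 15 _∣_

𝟎 : Process
𝟎 = nil

ν : Name → Process → Process
ν x P = new (bind x P)

_∣_ : Process → Process → Process
_∣_ = par

_[_]·_ : Name → Name → Process → Process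
x [ y ]· P = send (free x) (free y) P

_⦅_⦆·_ : Name → Name → Process → Process
x ⦅ y ⦆· P = receive (free x) (bind y P)

_◁_·_ : Name → Label → Process → Process
x ◁ ℓ · P = select (free x) ℓ P

_▷_·_ : Name → (I : Labels) → Vec Process ∣ I ∣ → Process
x ▷ I · Ps = branch (free x) I Ps

‼_⦅_⦆·_ : Name → Name → Process → Process
‼ x ⦅ y ⦆· P = serve (free x) (bind y P)

[_↔_] : Name → Name → Process
[ x ↔ y ] = forward (free x) (free y)

_[]·_ : Name → Process → Process
x []· P = close (free x) P

_⦅⦆·_ : Name → Process → Process
x ⦅⦆· P = wait (free x) P

-- Contexts are finite sets of assignments: lists considered up to permutation
-- (built into ⊢ below) with pairwise distinct names (Distinct).
Ctx : Set → Set
Ctx T = List (Name × T)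

infixl 10 _▹_∶_

∅ : {T : Set} → Ctx T
∅ = []

_▹_∶_ : {T : Set} → Ctx T → Name → T → Ctx T
Δ ▹ x ∶ A = (x , A) ∷ Δ

names : {T : Set} → Ctx T → List Name
names = map proj₁

Distinct : {T : Set} → Ctx T → Ctx T → Ctx T → Set
Distinct Γ Δ Λ = Unique (names (Γ ++ Δ ++ Λ))

infix 4 _⨾_⊢_⦂_ _⨾_⊩_⦂_ _⨾_⊢ᴵ_⦂_∶_ _⨾_⊩ᴵ_⦂_∶_

-- πULL.  Γ ⨾ Δ ⊩ P ⦂ Λ says that the sequent is, read literally, the conclusion
-- of a rule with derivable premises; ⊢ imposes distinctness of names on every
-- sequent of a derivation and identifies permuted contexts.
--
-- In the rules with conclusion ν y (x [ y ]· (P ∣ Q)), the bound name y occurs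
-- in the premise for P only; the usual convention that bound names differ from
-- the free ones is the explicit condition that y is not in the premise for Q.
mutual
  data _⨾_⊢_⦂_ (Γ Δ : Ctx Type) (P : Process) (Λ : Ctx Type) : Set where
    derive : {Γ′ Δ′ Λ′ : Ctx Type} →
             Distinct Γ Δ Λ → Γ′ ↭ Γ → Δ′ ↭ Δ → Λ′ ↭ Λ →
             Γ′ ⨾ Δ′ ⊩ P ⦂ Λ′ →
             Γ ⨾ Δ ⊢ P ⦂ Λ

  data _⨾_⊩_⦂_ : Ctx Type → Ctx Type → Process → Ctx Type → Set where

    idR : ∀ {Γ x y A} → Γ ⨾ ∅ ▹ x ∶ A ⊩ [ x ↔ y ] ⦂ ∅ ▹ y ∶ A

    idL : ∀ {Γ x y A} → Γ ⨾ ∅ ▹ x ∶ A ▹ y ∶ dual A ⊩ [ x ↔ y ] ⦂ ∅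

    𝟏R : ∀ {Γ x} → Γ ⨾ ∅ ⊩ x []· 𝟎 ⦂ ∅ ▹ x ∶ 𝟏

    𝟏L : ∀ {Γ Δ Λ P x} →
         Γ ⨾ Δ ⊢ P ⦂ Λ →
         Γ ⨾ Δ ▹ x ∶ 𝟏 ⊩ x ⦅⦆· P ⦂ Λ

    ⊥R : ∀ {Γ Δ Λ P x} →
         Γ ⨾ Δ ⊢ P ⦂ Λ →
         Γ ⨾ Δ ⊩ x ⦅⦆· P ⦂ Λ ▹ x ∶ ⊥

    ⊥L : ∀ {Γ x} → Γ ⨾ ∅ ▹ x ∶ ⊥ ⊩ x []· 𝟎 ⦂ ∅

    ⊗R : ∀ {Γ Δ Δ′ Λ Λ′ P Q x y A B} →
         y ∉ names (Γ ++ Δ′ ++ (Λ′ ▹ x ∶ B)) →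
         Γ ⨾ Δ ⊢ P ⦂ Λ ▹ y ∶ A →
         Γ ⨾ Δ′ ⊢ Q ⦂ Λ′ ▹ x ∶ B →
         Γ ⨾ Δ ++ Δ′ ⊩ ν y (x [ y ]· (P ∣ Q)) ⦂ (Λ ++ Λ′) ▹ x ∶ A ⊗ B

    ⊗L : ∀ {Γ Δ Λ P x y A B} →
         Γ ⨾ Δ ▹ y ∶ A ▹ x ∶ B ⊢ P ⦂ Λ →
         Γ ⨾ Δ ▹ x ∶ A ⊗ B ⊩ x ⦅ y ⦆· P ⦂ Λ

    ⅋R : ∀ {Γ Δ Λ P x y A B} →
         Γ ⨾ Δ ⊢ P ⦂ Λ ▹ y ∶ A ▹ x ∶ B →
         Γ ⨾ Δ ⊩ x ⦅ y ⦆· P ⦂ Λ ▹ x ∶ A ⅋ B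

    ⅋L : ∀ {Γ Δ Δ′ Λ Λ′ P Q x y A B} →
         y ∉ names (Γ ++ (Δ′ ▹ x ∶ B) ++ Λ′) →
         Γ ⨾ Δ ▹ y ∶ A ⊢ P ⦂ Λ →
         Γ ⨾ Δ′ ▹ x ∶ B ⊢ Q ⦂ Λ′ →
         Γ ⨾ (Δ ++ Δ′) ▹ x ∶ A ⅋ B ⊩ ν y (x [ y ]· (P ∣ Q)) ⦂ Λ ++ Λ′

    ⊸R : ∀ {Γ Δ Λ P x y A B} →
         Γ ⨾ Δ ▹ y ∶ A ⊢ P ⦂ Λ ▹ x ∶ B →
         Γ ⨾ Δ ⊩ x ⦅ y ⦆· P ⦂ Λ ▹ x ∶ A ⊸ B

    ⊸L : ∀ {Γ Δ Δ′ Λ Λ′ P Q x y A B} →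
         y ∉ names (Γ ++ (Δ′ ▹ x ∶ B) ++ Λ′) →
         Γ ⨾ Δ ⊢ P ⦂ Λ ▹ y ∶ A →
         Γ ⨾ Δ′ ▹ x ∶ B ⊢ Q ⦂ Λ′ →
         Γ ⨾ (Δ ++ Δ′) ▹ x ∶ A ⊸ B ⊩ ν y (x [ y ]· (P ∣ Q)) ⦂ Λ ++ Λ′

    ⊕R : ∀ {Γ Δ Λ P x I As} (j : Fin ∣ I ∣) →
         Γ ⨾ Δ ⊢ P ⦂ Λ ▹ x ∶ Vec.lookup As j →
         Γ ⨾ Δ ⊩ x ◁ label I j · P ⦂ Λ ▹ x ∶ ⊕ I As

    ⊕L : ∀ {Γ Δ Λ x I As Ps} →
         ((i : Fin ∣ I ∣) → Γ ⨾ Δ ▹ x ∶ Vec.lookup As i ⊢ Vec.lookup Ps i ⦂ Λ) →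
         Γ ⨾ Δ ▹ x ∶ ⊕ I As ⊩ x ▷ I · Ps ⦂ Λ

    &R : ∀ {Γ Δ Λ x I As Ps} →
         ((i : Fin ∣ I ∣) → Γ ⨾ Δ ⊢ Vec.lookup Ps i ⦂ Λ ▹ x ∶ Vec.lookup As i) →
         Γ ⨾ Δ ⊩ x ▷ I · Ps ⦂ Λ ▹ x ∶ & I As

    &L : ∀ {Γ Δ Λ P x I As} (j : Fin ∣ I ∣) →
         Γ ⨾ Δ ▹ x ∶ Vec.lookup As j ⊢ P ⦂ Λ →
         Γ ⨾ Δ ▹ x ∶ & I As ⊩ x ◁ label I j · P ⦂ Λ

    copyR : ∀ {Γ Δ Λ P x u A} →
            Γ ▹ u ∶ A ⨾ Δ ⊢ P ⦂ Λ ▹ x ∶ dual A →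
            Γ ▹ u ∶ A ⨾ Δ ⊩ ν x (u [ x ]· P) ⦂ Λ

    copyL : ∀ {Γ Δ Λ P x u A} →
            Γ ▹ u ∶ A ⨾ Δ ▹ x ∶ A ⊢ P ⦂ Λ →
            Γ ▹ u ∶ A ⨾ Δ ⊩ ν x (u [ x ]· P) ⦂ Λ

    !R : ∀ {Γ P x y A} →
         Γ ⨾ ∅ ⊢ P ⦂ ∅ ▹ y ∶ A →
         Γ ⨾ ∅ ⊩ ‼ x ⦅ y ⦆· P ⦂ ∅ ▹ x ∶ ! A

    !L : ∀ {Γ Δ Λ P x u A} →
         Γ ▹ u ∶ A ⨾ Δ ⊢ P ⦂ Λ →
         Γ ⨾ Δ ▹ x ∶ ! A ⊩ P ⟨ x / u ⟩ ⦂ Λ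

    ⁇R : ∀ {Γ Δ Λ P x u A} →
         Γ ▹ u ∶ A ⨾ Δ ⊢ P ⦂ Λ →
         Γ ⨾ Δ ⊩ P ⟨ x / u ⟩ ⦂ Λ ▹ x ∶ ⁇ (dual A)

    ⁇L : ∀ {Γ P x y A} →
         Γ ⨾ ∅ ▹ y ∶ A ⊢ P ⦂ ∅ →
         Γ ⨾ ∅ ▹ x ∶ ⁇ A ⊩ ‼ x ⦅ y ⦆· P ⦂ ∅

    cutRL : ∀ {Γ Δ Δ′ Λ Λ′ P Q x A} →
            Γ ⨾ Δ ⊢ P ⦂ Λ ▹ x ∶ A →
            Γ ⨾ Δ′ ▹ x ∶ A ⊢ Q ⦂ Λ′ →
            Γ ⨾ Δ ++ Δ′ ⊩ ν x (P ∣ Q) ⦂ Λ ++ Λ′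

    cutLR : ∀ {Γ Δ Δ′ Λ Λ′ P Q x A} →
            Γ ⨾ Δ ▹ x ∶ A ⊢ P ⦂ Λ →
            Γ ⨾ Δ′ ⊢ Q ⦂ Λ′ ▹ x ∶ A →
            Γ ⨾ Δ ++ Δ′ ⊩ ν x (P ∣ Q) ⦂ Λ ++ Λ′

    cutRR : ∀ {Γ Δ Δ′ Λ Λ′ P Q x A} →
            Γ ⨾ Δ ⊢ P ⦂ Λ ▹ x ∶ A →
            Γ ⨾ Δ′ ⊢ Q ⦂ Λ′ ▹ x ∶ dual A →
            Γ ⨾ Δ ++ Δ′ ⊩ ν x (P ∣ Q) ⦂ Λ ++ Λ′

    cutLL : ∀ {Γ Δ Δ′ Λ Λ′ P Q x A} →
            Γ ⨾ Δ ▹ x ∶ A ⊢ P ⦂ Λ →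
            Γ ⨾ Δ′ ▹ x ∶ dual A ⊢ Q ⦂ Λ′ →
            Γ ⨾ Δ ++ Δ′ ⊩ ν x (P ∣ Q) ⦂ Λ ++ Λ′

    cut!R : ∀ {Γ Δ Λ P Q x u A} →
            Γ ▹ u ∶ A ⨾ Δ ⊢ P ⦂ Λ →
            Γ ⨾ ∅ ⊢ Q ⦂ ∅ ▹ x ∶ A →
            Γ ⨾ Δ ⊩ ν u (P ∣ (‼ u ⦅ x ⦆· Q)) ⦂ Λ

    cut!L : ∀ {Γ Δ Λ P Q x u A} →
            Γ ⨾ ∅ ⊢ P ⦂ ∅ ▹ x ∶ A →
            Γ ▹ u ∶ A ⨾ Δ ⊢ Q ⦂ Λ →
            Γ ⨾ Δ ⊩ ν u ((‼ u ⦅ x ⦆· P) ∣ Q) ⦂ Λ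

    cut⁇R : ∀ {Γ Δ Λ P Q x u A} →
            Γ ▹ u ∶ A ⨾ Δ ⊢ P ⦂ Λ →
            Γ ⨾ ∅ ▹ x ∶ dual A ⊢ Q ⦂ ∅ →
            Γ ⨾ Δ ⊩ ν u (P ∣ (‼ u ⦅ x ⦆· Q)) ⦂ Λ

    cut⁇L : ∀ {Γ Δ Λ P Q x u A} →
            Γ ⨾ ∅ ▹ x ∶ dual A ⊢ P ⦂ ∅ →
            Γ ▹ u ∶ A ⨾ Δ ⊢ Q ⦂ Λ →
            Γ ⨾ Δ ⊩ ν u ((‼ u ⦅ x ⦆· P) ∣ Q) ⦂ Λ

-- πILL, with the same conventions.
mutual
  data _⨾_⊢ᴵ_⦂_∶_ (Γ Δ : Ctx Typeᴵ) (P : Process) (z : Name) (C : Typeᴵ) : Set where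
    derive : {Γ′ Δ′ : Ctx Typeᴵ} →
             Distinct Γ Δ (∅ ▹ z ∶ C) → Γ′ ↭ Γ → Δ′ ↭ Δ →
             Γ′ ⨾ Δ′ ⊩ᴵ P ⦂ z ∶ C →
             Γ ⨾ Δ ⊢ᴵ P ⦂ z ∶ C

  data _⨾_⊩ᴵ_⦂_∶_ : Ctx Typeᴵ → Ctx Typeᴵ → Process → Name → Typeᴵ → Set where

    id : ∀ {Γ x y A} → Γ ⨾ ∅ ▹ x ∶ A ⊩ᴵ [ x ↔ y ] ⦂ y ∶ A

    𝟏R : ∀ {Γ x} → Γ ⨾ ∅ ⊩ᴵ x []· 𝟎 ⦂ x ∶ 𝟏

    𝟏L : ∀ {Γ Δ P x z C} →
         Γ ⨾ Δ ⊢ᴵ P ⦂ z ∶ C →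
         Γ ⨾ Δ ▹ x ∶ 𝟏 ⊩ᴵ x ⦅⦆· P ⦂ z ∶ C

    ⊗R : ∀ {Γ Δ Δ′ P Q x y A B} →
         y ∉ names (Γ ++ Δ′ ++ (∅ ▹ x ∶ B)) →
         Γ ⨾ Δ ⊢ᴵ P ⦂ y ∶ A →
         Γ ⨾ Δ′ ⊢ᴵ Q ⦂ x ∶ B →
         Γ ⨾ Δ ++ Δ′ ⊩ᴵ ν y (x [ y ]· (P ∣ Q)) ⦂ x ∶ A ⊗ B

    ⊗L : ∀ {Γ Δ P x y z A B C} →
         Γ ⨾ Δ ▹ y ∶ A ▹ x ∶ B ⊢ᴵ P ⦂ z ∶ C →
         Γ ⨾ Δ ▹ x ∶ A ⊗ B ⊩ᴵ x ⦅ y ⦆· P ⦂ z ∶ C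

    ⊸R : ∀ {Γ Δ P x y A B} →
         Γ ⨾ Δ ▹ y ∶ A ⊢ᴵ P ⦂ x ∶ B →
         Γ ⨾ Δ ⊩ᴵ x ⦅ y ⦆· P ⦂ x ∶ A ⊸ B

    ⊸L : ∀ {Γ Δ Δ′ P Q x y z A B C} →
         y ∉ names (Γ ++ (Δ′ ▹ x ∶ B) ++ (∅ ▹ z ∶ C)) →
         Γ ⨾ Δ ⊢ᴵ P ⦂ y ∶ A →
         Γ ⨾ Δ′ ▹ x ∶ B ⊢ᴵ Q ⦂ z ∶ C →
         Γ ⨾ (Δ ++ Δ′) ▹ x ∶ A ⊸ B ⊩ᴵ ν y (x [ y ]· (P ∣ Q)) ⦂ z ∶ C

    ⊕R : ∀ {Γ Δ P x I As} (j : Fin ∣ I ∣) →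
         Γ ⨾ Δ ⊢ᴵ P ⦂ x ∶ Vec.lookup As j →
         Γ ⨾ Δ ⊩ᴵ x ◁ label I j · P ⦂ x ∶ ⊕ I As

    ⊕L : ∀ {Γ Δ x z C I As Ps} →
         ((i : Fin ∣ I ∣) → Γ ⨾ Δ ▹ x ∶ Vec.lookup As i ⊢ᴵ Vec.lookup Ps i ⦂ z ∶ C) →
         Γ ⨾ Δ ▹ x ∶ ⊕ I As ⊩ᴵ x ▷ I · Ps ⦂ z ∶ C

    &R : ∀ {Γ Δ x I As Ps} →
         ((i : Fin ∣ I ∣) → Γ ⨾ Δ ⊢ᴵ Vec.lookup Ps i ⦂ x ∶ Vec.lookup As i) →
         Γ ⨾ Δ ⊩ᴵ x ▷ I · Ps ⦂ x ∶ & I As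

    &L : ∀ {Γ Δ P x z C I As} (j : Fin ∣ I ∣) →
         Γ ⨾ Δ ▹ x ∶ Vec.lookup As j ⊢ᴵ P ⦂ z ∶ C →
         Γ ⨾ Δ ▹ x ∶ & I As ⊩ᴵ x ◁ label I j · P ⦂ z ∶ C

    copy : ∀ {Γ Δ P x u z A C} →
           Γ ▹ u ∶ A ⨾ Δ ▹ x ∶ A ⊢ᴵ P ⦂ z ∶ C →
           Γ ▹ u ∶ A ⨾ Δ ⊩ᴵ ν x (u [ x ]· P) ⦂ z ∶ C

    !R : ∀ {Γ P x y A} →
         Γ ⨾ ∅ ⊢ᴵ P ⦂ y ∶ A →
         Γ ⨾ ∅ ⊩ᴵ ‼ x ⦅ y ⦆· P ⦂ x ∶ ! A

    !L : ∀ {Γ Δ P x u z A C} →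
         Γ ▹ u ∶ A ⨾ Δ ⊢ᴵ P ⦂ z ∶ C →
         Γ ⨾ Δ ▹ x ∶ ! A ⊩ᴵ P ⟨ x / u ⟩ ⦂ z ∶ C

    cutRL : ∀ {Γ Δ Δ′ P Q x z A C} →
            Γ ⨾ Δ ⊢ᴵ P ⦂ x ∶ A →
            Γ ⨾ Δ′ ▹ x ∶ A ⊢ᴵ Q ⦂ z ∶ C →
            Γ ⨾ Δ ++ Δ′ ⊩ᴵ ν x (P ∣ Q) ⦂ z ∶ C

    cutLR : ∀ {Γ Δ Δ′ P Q x z A C} →
            Γ ⨾ Δ ▹ x ∶ A ⊢ᴵ P ⦂ z ∶ C →
            Γ ⨾ Δ′ ⊢ᴵ Q ⦂ x ∶ A →
            Γ ⨾ Δ ++ Δ′ ⊩ᴵ ν x (P ∣ Q) ⦂ z ∶ C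

    cut!R : ∀ {Γ Δ P Q x u z A C} →
            Γ ▹ u ∶ A ⨾ Δ ⊢ᴵ P ⦂ z ∶ C →
            Γ ⨾ ∅ ⊢ᴵ Q ⦂ x ∶ A →
            Γ ⨾ Δ ⊩ᴵ ν u (P ∣ (‼ u ⦅ x ⦆· Q)) ⦂ z ∶ C

    cut!L : ∀ {Γ Δ P Q x u z A C} →
            Γ ⨾ ∅ ⊢ᴵ P ⦂ x ∶ A →
            Γ ▹ u ∶ A ⨾ Δ ⊢ᴵ Q ⦂ z ∶ C →
            Γ ⨾ Δ ⊩ᴵ ν u ((‼ u ⦅ x ⦆· P) ∣ Q) ⦂ z ∶ C

𝓘 : Pred Process 0ℓ
𝓘 P = ∃[ Γ ] ∃[ Δ ] ∃[ x ] ∃[ A ] Γ ⨾ Δ ⊢ᴵ P ⦂ x ∶ A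

𝓤 : Pred Process 0ℓ
𝓤 P = ∃[ Γ ] ∃[ Δ ] ∃[ Λ ] Γ ⨾ Δ ⊢ P ⦂ Λ

{-# OPTIONS --safe #-}

-- πILL is the fragment of πULL in which every right context is a singleton, so
-- its derivations embed rule by rule.  Conversely, y[].𝟎 has the name y on the
-- right of every πILL sequent that it inhabits, and neither x(). nor !L can
-- change this; but a bound name y received on x enters the premise on the left.
module Submission where

open import Defs
open import Data.Fin using (Fin; zero)
open import Data.List using ([]; _∷_; _++_; map)
open import Data.List.Membership.Propositional using () renaming (_∈_ to _∈ˡ_; _∉_ to _∉ˡ_)
open import Data.List.Membership.Propositional.Properties using (∈-++⁺ʳ)
open import Data.List.Properties using (map-++; map-∘; ++-assoc)
open import Data.List.Relation.Binary.Permutation.Propositional using (↭-refl)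
open import Data.List.Relation.Binary.Permutation.Propositional.Properties using (map⁺)
open import Data.List.Relation.Unary.All as All using ([]; _∷_)
open import Data.List.Relation.Unary.AllPairs using ([]; _∷_)
open import Data.List.Relation.Unary.Any using (here; there)
open import Data.List.Relation.Unary.Unique.Propositional using (Unique)
open import Data.Nat using (ℕ; _≟_)
open import Data.Product using (_×_; _,_; map₂)
open import Data.Vec as Vec using (Vec; []; _∷_)
open import Relation.Binary.PropositionalEquality as ≡
  using (_≡_; _≢_; refl; sym; trans; cong)
open import Relation.Nullary using (¬_; yes; no; contradiction)
open import Relation.Unary using (_∈_; _⊆_; _⊂_; _∖_)

mutual
  embed : Typeᴵ → Type
  embed 𝟏        = 𝟏
  embed (A ⊗ B)  = embed A ⊗ embed B
  embed (A ⊸ B)  = embed A ⊸ embed B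
  embed (⊕ I As) = ⊕ I (embeds As)
  embed (& I As) = & I (embeds As)
  embed (! A)    = ! embed A

  embeds : {n : ℕ} → Vec Typeᴵ n → Vec Type n
  embeds []       = []
  embeds (A ∷ As) = embed A ∷ embeds As

lookup-embeds : ∀ {n} (As : Vec Typeᴵ n) i →
                Vec.lookup (embeds As) i ≡ embed (Vec.lookup As i)
lookup-embeds (A ∷ As) zero        = refl
lookup-embeds (A ∷ As) (Fin.suc i) = lookup-embeds As i

⟦_⟧ : Ctx Typeᴵ → Ctx Type
⟦_⟧ = map (map₂ embed)

⟦⟧-++ : ∀ Γ Δ → ⟦ Γ ++ Δ ⟧ ≡ ⟦ Γ ⟧ ++ ⟦ Δ ⟧
⟦⟧-++ = map-++ (map₂ embed)

-- Embedding acts on types alone, so `Distinct` and the freshness conditions of `⊗R` and `⊸L`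
-- transfer along this equation.
names-⟦⟧ : ∀ Γ Δ Λ → names (Γ ++ Δ ++ Λ) ≡ names (⟦ Γ ⟧ ++ ⟦ Δ ⟧ ++ ⟦ Λ ⟧)
names-⟦⟧ Γ Δ Λ =
  trans (map-∘ (Γ ++ Δ ++ Λ))
        (cong names (trans (⟦⟧-++ Γ (Δ ++ Λ)) (cong (⟦ Γ ⟧ ++_) (⟦⟧-++ Δ Λ))))

∉-⟦⟧ : ∀ {y} Γ Δ Λ → y ∉ˡ names (Γ ++ Δ ++ Λ) → y ∉ˡ names (⟦ Γ ⟧ ++ ⟦ Δ ⟧ ++ ⟦ Λ ⟧)
∉-⟦⟧ {y} Γ Δ Λ = ≡.subst (y ∉ˡ_) (names-⟦⟧ Γ Δ Λ)

mutual
  ⊢ᴵ⇒⊢ : ∀ {Γ Δ P z C} → Γ ⨾ Δ ⊢ᴵ P ⦂ z ∶ C → ⟦ Γ ⟧ ⨾ ⟦ Δ ⟧ ⊢ P ⦂ ∅ ▹ z ∶ embed C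
  ⊢ᴵ⇒⊢ {Γ} {Δ} (derive dist γ δ D) =
    derive (≡.subst Unique (names-⟦⟧ Γ Δ _) dist) (map⁺ _ γ) (map⁺ _ δ) ↭-refl (⊩ᴵ⇒⊩ D)

  ⊩ᴵ⇒⊩ : ∀ {Γ Δ P z C} → Γ ⨾ Δ ⊩ᴵ P ⦂ z ∶ C → ⟦ Γ ⟧ ⨾ ⟦ Δ ⟧ ⊩ P ⦂ ∅ ▹ z ∶ embed C
  ⊩ᴵ⇒⊩ id = idR
  ⊩ᴵ⇒⊩ 𝟏R = 𝟏R
  ⊩ᴵ⇒⊩ (𝟏L D) = 𝟏L (⊢ᴵ⇒⊢ D)
  -- The rewrite exposes the split of the left context that a rule with two premises expects.
  ⊩ᴵ⇒⊩ (⊗R {Γ} {Δ} {Δ′} y∉ D E) rewrite ⟦⟧-++ Δ Δ′ =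
    ⊗R (∉-⟦⟧ Γ Δ′ _ y∉) (⊢ᴵ⇒⊢ D) (⊢ᴵ⇒⊢ E)
  ⊩ᴵ⇒⊩ (⊗L D) = ⊗L (⊢ᴵ⇒⊢ D)
  ⊩ᴵ⇒⊩ (⊸R D) = ⊸R (⊢ᴵ⇒⊢ D)
  ⊩ᴵ⇒⊩ (⊸L {Γ} {Δ} {Δ′} y∉ D E) rewrite ⟦⟧-++ Δ Δ′ =
    ⊸L (∉-⟦⟧ Γ (Δ′ ▹ _ ∶ _) _ y∉) (⊢ᴵ⇒⊢ D) (⊢ᴵ⇒⊢ E)
  ⊩ᴵ⇒⊩ (⊕R {As = As} j D) =
    ⊕R j (≡.subst (λ A → _ ⨾ _ ⊢ _ ⦂ ∅ ▹ _ ∶ A) (sym (lookup-embeds As j)) (⊢ᴵ⇒⊢ D))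
  ⊩ᴵ⇒⊩ (⊕L {As = As} Ds) =
    ⊕L λ i → ≡.subst (λ A → _ ⨾ _ ▹ _ ∶ A ⊢ _ ⦂ _) (sym (lookup-embeds As i)) (⊢ᴵ⇒⊢ (Ds i))
  ⊩ᴵ⇒⊩ (&R {As = As} Ds) =
    &R λ i → ≡.subst (λ A → _ ⨾ _ ⊢ _ ⦂ ∅ ▹ _ ∶ A) (sym (lookup-embeds As i)) (⊢ᴵ⇒⊢ (Ds i))
  ⊩ᴵ⇒⊩ (&L {As = As} j D) =
    &L j (≡.subst (λ A → _ ⨾ _ ▹ _ ∶ A ⊢ _ ⦂ _) (sym (lookup-embeds As j)) (⊢ᴵ⇒⊢ D))
  ⊩ᴵ⇒⊩ (copy D) = copyL (⊢ᴵ⇒⊢ D)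
  ⊩ᴵ⇒⊩ (!R D) = !R (⊢ᴵ⇒⊢ D)
  ⊩ᴵ⇒⊩ (!L D) = !L (⊢ᴵ⇒⊢ D)
  ⊩ᴵ⇒⊩ (cutRL {Δ = Δ} {Δ′} D E) rewrite ⟦⟧-++ Δ Δ′ = cutRL (⊢ᴵ⇒⊢ D) (⊢ᴵ⇒⊢ E)
  ⊩ᴵ⇒⊩ (cutLR {Δ = Δ} {Δ′} D E) rewrite ⟦⟧-++ Δ Δ′ = cutLR (⊢ᴵ⇒⊢ D) (⊢ᴵ⇒⊢ E)
  ⊩ᴵ⇒⊩ (cut!R D E) = cut!R (⊢ᴵ⇒⊢ D) (⊢ᴵ⇒⊢ E)
  ⊩ᴵ⇒⊩ (cut!L D E) = cut!L (⊢ᴵ⇒⊢ D) (⊢ᴵ⇒⊢ E)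

𝓘⊆𝓤 : 𝓘 ⊆ 𝓤
𝓘⊆𝓤 (_ , _ , _ , _ , D) = _ , _ , _ , ⊢ᴵ⇒⊢ D

-- `z` ends the list, hence lies after `u`, and uniqueness at the position of `u` excludes it.
Unique-last-≢ : ∀ {T : Set} {u z} {A C : T} (Ξ : Ctx T) → (u , A) ∈ˡ Ξ →
                Unique (names (Ξ ++ (∅ ▹ z ∶ C))) → z ≢ u
Unique-last-≢ (_ ∷ Ξ) (here refl) (u∉ ∷ _) z≡u =
  All.lookup u∉ (z∈ Ξ) (sym z≡u)
  where
  z∈ : ∀ {T : Set} {z} {C : T} (Ξ : Ctx T) → z ∈ˡ names (Ξ ++ (∅ ▹ z ∶ C))
  z∈ []      = here refl
  z∈ (_ ∷ Ξ) = there (z∈ Ξ)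
Unique-last-≢ (_ ∷ Ξ) (there u∈) (_ ∷ uniq) = Unique-last-≢ Ξ u∈ uniq

-- Distinctness spans all three zones of a sequent. This keeps the right name untouched when `!L`
-- renames `u` or a receive binds a left name.
⊢ᴵ-right-≢ : ∀ {Γ Δ P z C u A} → Γ ⨾ Δ ⊢ᴵ P ⦂ z ∶ C → (u , A) ∈ˡ Γ ++ Δ → z ≢ u
⊢ᴵ-right-≢ {Γ} {Δ} (derive dist _ _ _) u∈ =
  Unique-last-≢ (Γ ++ Δ) u∈ (≡.subst Unique (cong names (sym (++-assoc Γ Δ _))) dist)

-- `Chan 0` has no indices, so a renaming sends free names to free names only.
substChan-free≢bound : ∀ {n x i} (σ : Name → Chan 0) → substChan σ {n} (free x) ≢ bound i
substChan-free≢bound {x = x} σ with σ x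
... | free _ = λ ()

substChan-self : ∀ y → substChan (y ↦ bound {1} zero) {0} (free y) ≡ bound zero
substChan-self y with y ≟ y
... | yes _   = refl
... | no  y≢y = contradiction refl y≢y

substChan-fresh : ∀ {d n u z} {a : Chan d} → z ≢ u → substChan (u ↦ a) {n} (free z) ≡ free z
substChan-fresh {u = u} {z} z≢u with z ≟ u
... | yes z≡u = contradiction z≡u z≢u
... | no  _   = refl

-- The shape of P is passed as an equation because the conclusion P ⟨ x / u ⟩ of
-- !L does not unify with a pattern.
mutual
  ⊢ᴵ-close : ∀ {Γ Δ P z C c} → Γ ⨾ Δ ⊢ᴵ P ⦂ z ∶ C → P ≡ close c nil → c ≡ free z
  ⊢ᴵ-close (derive _ _ _ D) = ⊩ᴵ-close D

  ⊩ᴵ-close : ∀ {Γ Δ P z C c} → Γ ⨾ Δ ⊩ᴵ P ⦂ z ∶ C → P ≡ close c nil → c ≡ free z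
  ⊩ᴵ-close 𝟏R refl = refl
  -- Substitution preserves shape, so the premise types a `close` too; by induction its subject is
  -- the right name, which differs from the renamed `u`.
  ⊩ᴵ-close (!L {P = close c nil} D) refl with refl ← ⊢ᴵ-close D refl =
    substChan-fresh (⊢ᴵ-right-≢ D (here refl))

mutual
  -- Up to renaming by `!L`, only `𝟏L` creates a `wait` in πILL, and it leaves the right assignment
  -- alone.
  ⊢ᴵ-wait-close : ∀ {Γ Δ P z C b c} → Γ ⨾ Δ ⊢ᴵ P ⦂ z ∶ C → P ≡ wait b (close c nil) → c ≡ free z
  ⊢ᴵ-wait-close (derive _ _ _ D) = ⊩ᴵ-wait-close D

  ⊩ᴵ-wait-close : ∀ {Γ Δ P z C b c} → Γ ⨾ Δ ⊩ᴵ P ⦂ z ∶ C → P ≡ wait b (close c nil) → c ≡ free z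
  ⊩ᴵ-wait-close (𝟏L D) refl = ⊢ᴵ-close D refl
  ⊩ᴵ-wait-close (!L {P = wait b (close c nil)} D) refl with refl ← ⊢ᴵ-wait-close D refl =
    substChan-fresh (⊢ᴵ-right-≢ D (here refl))

wait-close-injective : ∀ {n} {b b′ c c′ : Chan n} →
                       wait b (close c nil) ≡ wait b′ (close c′ nil) → c ≡ c′
wait-close-injective refl = refl

receive-injective : ∀ {n} {a a′ : Chan n} {P P′} → receive a P ≡ receive a′ P′ → P ≡ P′
receive-injective refl = refl

-- Binding `y` makes an index only out of `y` itself, yet the closed name is the right name of the
-- sequent, which differs from every left name.
¬⊢ᴵ-left-wait-close : ∀ {Γ Δ P y A b z C} → Γ ⨾ Δ ⊢ᴵ P ⦂ z ∶ C → (y , A) ∈ˡ Δ →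
                      bind y P ≢ wait b (close (bound zero) nil)
¬⊢ᴵ-left-wait-close {Γ} {P = wait _ (close c nil)} {y} D y∈ eq
  with refl ← ⊢ᴵ-wait-close D refl
  with () ← trans (sym (substChan-fresh (⊢ᴵ-right-≢ D (∈-++⁺ʳ Γ y∈)))) (wait-close-injective eq)

mutual
  -- Both rules for a receive, `⊗L` and `⊸R`, place the received name on the left; otherwise the
  -- derivation ends in `!L`, which only renames free names.
  ¬⊢ᴵ-receive-wait-close : ∀ {Γ Δ P z C a b} → Γ ⨾ Δ ⊢ᴵ P ⦂ z ∶ C →
                           P ≢ receive a (wait b (close (bound zero) nil))
  ¬⊢ᴵ-receive-wait-close (derive _ _ _ D) = ¬⊩ᴵ-receive-wait-close D

  ¬⊩ᴵ-receive-wait-close : ∀ {Γ Δ P z C a b} → Γ ⨾ Δ ⊩ᴵ P ⦂ z ∶ C →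
                           P ≢ receive a (wait b (close (bound zero) nil))
  ¬⊩ᴵ-receive-wait-close (⊗L D) eq =
    ¬⊢ᴵ-left-wait-close D (there (here refl)) (receive-injective eq)
  ¬⊩ᴵ-receive-wait-close (⊸R D) eq =
    ¬⊢ᴵ-left-wait-close D (here refl) (receive-injective eq)
  ¬⊩ᴵ-receive-wait-close (!L {P = receive _ (wait _ (close (bound zero) nil))} D) eq =
    ¬⊢ᴵ-receive-wait-close D refl
  -- A free subject stays free under the renaming, so it cannot have become the index.
  ¬⊩ᴵ-receive-wait-close (!L {P = receive _ (wait _ (close (free c) nil))} {x} {u} D) eq =
    substChan-free≢bound (u ↦ free x) (wait-close-injective (receive-injective eq))

-- `⅋R` puts `y : 𝟏` and `x : ⊥` on the right together; `⊥R` then handles `x` and `𝟏R` closes `y`.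
receive-wait-close∈𝓤 : ∀ {x y} → x ≢ y → x ⦅ y ⦆· x ⦅⦆· y []· 𝟎 ∈ 𝓤
receive-wait-close∈𝓤 {x} x≢y = ∅ , ∅ , (∅ ▹ x ∶ 𝟏 ⅋ ⊥) ,
  derive ([] ∷ []) ↭-refl ↭-refl ↭-refl
    (⅋R (derive ((x≢y ∷ []) ∷ [] ∷ []) ↭-refl ↭-refl ↭-refl
      (⊥R (derive ([] ∷ []) ↭-refl ↭-refl ↭-refl 𝟏R))))

receive-wait-close∉𝓘 : ∀ x y → ¬ (x ⦅ y ⦆· x ⦅⦆· y []· 𝟎 ∈ 𝓘)
receive-wait-close∉𝓘 x y (_ , _ , _ , _ , D) = ¬⊢ᴵ-receive-wait-close D
  -- The test `y ≟ y` inside `bind y` is stuck for a variable `y`. The subject of `wait` stays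
  -- unevaluated, as any subject is allowed there.
  (cong (λ c → receive (free x) (wait (substChan {1} (y ↦ bound zero) {0} (free x)) (close c nil)))
        (substChan-self y))

mainTheorem8 : 𝓘 ⊂ 𝓤 × ((x y : Name) → x ≢ y → x ⦅ y ⦆· x ⦅⦆· y []· 𝟎 ∈ 𝓤 ∖ 𝓘)
mainTheorem8 =
  (𝓘⊆𝓤 , λ 𝓤⊆𝓘 → receive-wait-close∉𝓘 0 1 (𝓤⊆𝓘 (receive-wait-close∈𝓤 0≢1))) ,
  λ x y x≢y → receive-wait-close∈𝓤 x≢y , receive-wait-close∉𝓘 x y
  where
  0≢1 : 0 ≢ 1
  0≢1 ()
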